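{- There exist an odd positive integer $M$ and an integer $\alpha$ such that the residue class $\{x\in\mathbb{Z}:\ x\equiv\alpha\pmod{M}\}$ contains no integer of the form $p^2+b^2+2^n$ with $p$ prime and $b,n\in\mathbb{N}$.
   Context: $\mathbb{N}=\{0,1,2,\ldots\}$. -}

module Defs where

open import Data.Nat.Base using (ℕ; _+_; _^_)
open import Data.Nat.Divisibility using (_∤_)
open import Data.Nat.Primality using (Prime)
open import Data.Integer.Base as ℤ using (ℤ; +_)
open import Data.Integer.Divisibility.Signed as ℤ using ()
open import Data.Product.Base using (_×_; ∃-syntax)
open import Relation.Binary.PropositionalEquality.Core using (_≡_)

Odd : ℕ → Set
Odd m = 2 ∤ m

infix 4 _≡_[mod_]

_≡_[mod_] : ℤ → ℤ → ℕ → Set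
x ≡ y [mod m ] = + m ℤ.∣ x ℤ.- y

PrimeSquare+Square+PowerOf2 : ℤ → Set
PrimeSquare+Square+PowerOf2 x =
  ∃[ p ] ∃[ b ] ∃[ n ] Prime p × x ≡ + (p ^ 2 + b ^ 2 + 2 ^ n)

{-# OPTIONS --safe #-}

-- A prime q ≡ 3 (mod 4) divides p² + b² with p prime only if p = q.  Take M to
-- be a product of such primes and choose α so that every α − 2ⁿ is divisible
-- by one of them, i.e. so that the congruences 2ⁿ ≡ α (mod q) cover all n.
-- Then x = p² + b² + 2ⁿ with x ≡ α (mod M) forces p to be the covering prime q,
-- and this is excluded because x − q² − 2ⁿ is a quadratic non-residue modulo
-- some prime factor r of M.  Everything depends only on n modulo the order of 2.
module Submission where

open import Defs
open import Data.Nat.Base using (ℕ; _<_)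
open import Data.Integer.Base using (ℤ)
open import Data.Product.Base using (_×_; ∃-syntax)
open import Relation.Nullary.Negation.Core using (¬_)

open import Data.Integer.Base as ℤ using () renaming (+_ to pos)
open import Data.Integer.Divisibility.Signed using (∣⇒∣ᵤ)
import Data.Integer.Properties as ℤ
open import Data.List.Base using (List; []; _∷_)
open import Data.List.Membership.Propositional using (find)
open import Data.List.Relation.Unary.All as All using (All; all?; lookup)
open import Data.List.Relation.Unary.Any using (Any; any?)
open import Data.Nat.Base
  using (zero; suc; _+_; _*_; _∸_; _^_; _≤_; s≤s; s≤s⁻¹; z<s; NonZero; >-nonZero)
open import Data.Nat.Coprimality using (Coprime; coprime-Bézout)
open import Data.Nat.Divisibility
open import Data.Nat.DivMod using (_/_; _%_; m≡m%n+[m/n]*n; m%n<n; m%n≤n)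
open import Data.Nat.GCD using (module Bézout)
open import Data.Nat.Induction using (<-rec)
open import Data.Nat.ListAction using (product)
open import Data.Nat.ListAction.Properties using (∈⇒∣product)
open import Data.Nat.Primality
  using (Prime; Irreducible; prime⇒irreducible)
open import Data.Nat.Properties
open import Data.Nat.Tactic.RingSolver using (solve-∀)
open import Data.Product.Base using (_,_; proj₁)
open import Data.Sum.Base using (_⊎_; inj₁; inj₂)
open import Function.Base using (_$_)
open import Relation.Binary.PropositionalEquality
  using (_≡_; _≢_; refl; sym; trans; cong; subst; module ≡-Reasoning)
open import Relation.Nullary.Decidable
  using (Dec; yes; no; toWitness; ¬?; _×-dec_; _⊎-dec_; _→-dec_)
open import Relation.Nullary.Negation.Core using (contradiction)

-- Square roots of -1 modulo `q`.

even-or-odd : ∀ n → 2 ∣ n ⊎ 2 ∣ suc n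
even-or-odd zero = inj₁ (2 ∣0)
even-or-odd (suc n) with even-or-odd n
... | inj₁ 2∣n = inj₂ (∣m∣n⇒∣m+n ∣-refl 2∣n)
... | inj₂ 2∣1+n = inj₁ 2∣1+n

-- Here `e` is -`c` modulo `q`, so the two squares agree; the identity expresses this without
-- subtraction.
∣1+square-neg : ∀ {q c} e → q ∣ e + c → q ∣ 1 + c * c → q ∣ 1 + e * e
∣1+square-neg {q} {c} e q∣e+c q∣1+c² = ∣m+n∣m⇒∣n
  (subst (q ∣_) (identity e c) (∣m∣n⇒∣m+n q∣1+c² (∣n⇒∣m*n e q∣e+c)))
  (∣n⇒∣m*n c q∣e+c)
  where
  identity : ∀ e c → (1 + c * c) + e * (e + c) ≡ c * (e + c) + (1 + e * e)
  identity = solve-∀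

∣[n∸m%n]+m : ∀ n m .{{_ : NonZero n}} → n ∣ (n ∸ m % n) + m
∣[n∸m%n]+m n m = divides (suc (m / n)) eq
  where
  open ≡-Reasoning
  eq : (n ∸ m % n) + m ≡ n + (m / n) * n
  eq = begin
    (n ∸ m % n) + m                         ≡⟨ cong (_+_ (n ∸ m % n)) (m≡m%n+[m/n]*n m n) ⟩
    (n ∸ m % n) + (m % n + (m / n) * n)     ≡⟨ +-assoc (n ∸ m % n) (m % n) _ ⟨
    (n ∸ m % n) + m % n + (m / n) * n       ≡⟨ cong (_+ (m / n) * n) (m∸n+n≡m (m%n≤n m n)) ⟩
    n + (m / n) * n                         ∎

-- As `q` is odd, one of a root and its negative is even. Evenness makes 4 divide e², which the
-- descent uses.
even-root : ∀ {q} .{{_ : NonZero q}} → 2 ∣ suc q → ∀ c → q ∣ 1 + c * c →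
            ∃[ e ] e < q × 2 ∣ e × q ∣ 1 + e * e
even-root {q} 2∣1+q c q∣1+c² = choose (even-or-odd e)
  where
  -- The representative of -`c` between 1 and `q`; the value `q` is odd, so parity gives the strict
  -- bound.
  e = q ∸ c % q

  e≤q : e ≤ q
  e≤q = m∸n≤m q (c % q)

  q∣1+e² : q ∣ 1 + e * e
  q∣1+e² = ∣1+square-neg e (∣[n∸m%n]+m q c) q∣1+c²

  2∤q : 2 ∤ q
  2∤q 2∣q with () ← ∣1⇒≡1 (∣m+n∣m⇒∣n (subst (2 ∣_) (+-comm 1 q) 2∣1+q) 2∣q)

  1+e+[q∸e]≡1+q : suc e + (q ∸ e) ≡ suc q
  1+e+[q∸e]≡1+q = cong suc (m+[n∸m]≡n e≤q)

  even<q : ∀ {f} → 2 ∣ f → f ≤ q → f < q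
  even<q 2∣f f≤q = ≤∧≢⇒< f≤q λ { refl → 2∤q 2∣f }

  choose : 2 ∣ e ⊎ 2 ∣ suc e → ∃[ f ] f < q × 2 ∣ f × q ∣ 1 + f * f
  choose (inj₁ 2∣e) = e , even<q 2∣e e≤q , 2∣e , q∣1+e²
  choose (inj₂ 2∣1+e) = q ∸ e , even<q 2∣q∸e (m∸n≤m q e) , 2∣q∸e ,
    ∣1+square-neg (q ∸ e) (subst (q ∣_) (sym (m∸n+n≡m e≤q)) ∣-refl) q∣1+e²
    where
    2∣q∸e : 2 ∣ q ∸ e
    2∣q∸e = ∣m+n∣m⇒∣n (subst (2 ∣_) (sym 1+e+[q∸e]≡1+q) 2∣1+q) 2∣1+e

-- Descent: for an even root e < q, the cofactor (1 + e²) / q is smaller than q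
-- and again congruent to 3 modulo 4.
≡3mod4⇒∤1+square : ∀ q → 4 ∣ suc q → ∀ c → q ∤ 1 + c * c
≡3mod4⇒∤1+square = <-rec _ step
  where
  step : ∀ q → (∀ {m} → m < q → 4 ∣ suc m → ∀ c → m ∤ 1 + c * c) →
         4 ∣ suc q → ∀ c → q ∤ 1 + c * c
  step zero _ 4∣1 with () ← ∣1⇒≡1 4∣1
  step q@(suc q-1) rec 4∣1+q c q∣1+c²
    with e , e<q , 2∣e , q∣1+e²@(divides m 1+e²≡m*q) ←
      even-root (∣-trans (divides 2 refl) 4∣1+q) c q∣1+c²
    = rec m<q 4∣1+m e (divides q (trans 1+e²≡m*q (*-comm m q)))
    where
    0<q-1 : 0 < q-1
    0<q-1 = s≤s⁻¹ (s≤s⁻¹ (≤-trans (s≤s (s≤s z<s)) (∣⇒≤ 4∣1+q)))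

    m<q : m < q
    m<q = *-cancelʳ-< q m q $ begin-strict
      m * q               ≡⟨ 1+e²≡m*q ⟨
      1 + e * e           ≤⟨ s≤s (*-mono-≤ (s≤s⁻¹ e<q) (<⇒≤ e<q)) ⟩
      1 + q-1 * q         <⟨ +-monoˡ-< (q-1 * q) (s≤s 0<q-1) ⟩
      q * q               ∎
      where open ≤-Reasoning

    -- Since 4 divides both `suc q` and e², this identity passes the divisibility on to `suc m`.
    m*[1+q]≡e²+[1+m] : m * suc q ≡ e * e + suc m
    m*[1+q]≡e²+[1+m] = begin
      m * suc q           ≡⟨ *-suc m q ⟩
      m + m * q           ≡⟨ cong (m +_) 1+e²≡m*q ⟨
      m + (1 + e * e)     ≡⟨ +-comm m (1 + e * e) ⟩
      1 + e * e + m       ≡⟨ +-suc (e * e) m ⟨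
      e * e + suc m       ∎
      where open ≡-Reasoning

    4∣1+m : 4 ∣ suc m
    4∣1+m = ∣m+n∣m⇒∣n
      (subst (4 ∣_) m*[1+q]≡e²+[1+m] (∣n⇒∣m*n m 4∣1+q))
      (*-pres-∣ 2∣e 2∣e)

-- Primes dividing a sum of two squares.

-- Multiply by s², where `s * a` is 1 or -1 modulo `q` by Bézout; the sign disappears on squaring,
-- so `s * b` works in both cases.
coprime∧∣sum-of-squares⇒∣1+square :
  ∀ {a q} → Coprime a q → ∀ b → q ∣ a * a + b * b → ∃[ c ] q ∣ 1 + c * c
coprime∧∣sum-of-squares⇒∣1+square {a} {q} a⊥q b q∣a²+b²
  with coprime-Bézout a⊥q
... | Bézout.+- s t 1+tq≡sa = s * b , ∣m+n∣m⇒∣n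
      (subst (q ∣_) expand (∣n⇒∣m*n (s * s) q∣a²+b²))
      (divides (t * (2 + t * q)) refl)
      where
      open ≡-Reasoning
      distribute : ∀ s a b → s * s * (a * a + b * b) ≡ s * a * (s * a) + s * b * (s * b)
      distribute = solve-∀
      regroup : ∀ q t v → (1 + t * q) * (1 + t * q) + v ≡ t * (2 + t * q) * q + (1 + v)
      regroup = solve-∀
      expand : s * s * (a * a + b * b) ≡ t * (2 + t * q) * q + (1 + s * b * (s * b))
      expand = begin
        s * s * (a * a + b * b)                            ≡⟨ distribute s a b ⟩
        s * a * (s * a) + s * b * (s * b)                  ≡⟨ cong (λ u → u * u + s * b * (s * b)) 1+tq≡sa ⟨
        (1 + t * q) * (1 + t * q) + s * b * (s * b)        ≡⟨ regroup q t _ ⟩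
        t * (2 + t * q) * q + (1 + s * b * (s * b))        ∎
... | Bézout.-+ s t 1+sa≡tq = s * b , ∣m+n∣m⇒∣n
      (subst (q ∣_) (expand s a b) (∣m∣n⇒∣m+n (∣n⇒∣m*n (s * s) q∣a²+b²) q∣1+sa))
      (∣n⇒∣m*n (s * a) q∣1+sa)
      where
      q∣1+sa : q ∣ 1 + s * a
      q∣1+sa = divides t 1+sa≡tq
      expand : ∀ s a b → s * s * (a * a + b * b) + (1 + s * a) ≡
                         s * a * (1 + s * a) + (1 + s * b * (s * b))
      expand = solve-∀

prime∧irreducible⇒coprime : ∀ {p q} → Prime p → Irreducible q → p ≢ q → Coprime p q
prime∧irreducible⇒coprime p-prime q-irr p≢q (d∣p , d∣q)
  with prime⇒irreducible p-prime d∣p | q-irr d∣q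
... | inj₁ d≡1 | _ = d≡1
... | inj₂ _ | inj₁ d≡1 = d≡1
... | inj₂ d≡p | inj₂ d≡q = contradiction (trans (sym d≡p) d≡q) p≢q

-- If `p` and `q` differ, `p` is invertible modulo `q` and -1 becomes a square, against the descent.
∣p²+b²⇒p≡q : ∀ {p q} → Prime p → Irreducible q → 4 ∣ suc q →
             ∀ b → q ∣ p * p + b * b → p ≡ q
∣p²+b²⇒p≡q {p} {q} p-prime q-irr 4∣1+q b q∣p²+b² with p ≟ q
... | yes p≡q = p≡q
... | no p≢q
    with c , q∣1+c² ← coprime∧∣sum-of-squares⇒∣1+square
           (prime∧irreducible⇒coprime p-prime q-irr p≢q) b q∣p²+b²
    = contradiction q∣1+c² (≡3mod4⇒∤1+square q 4∣1+q c)

-- Reductions to finite checks.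

-- Of two complementary divisors one is below `s`, since otherwise their product is at least
-- `s * s`.
trial-division : ∀ s {q} .{{_ : NonZero q}} → q < s * s →
                 (∀ {d} → d < s → d ∣ q → d ≡ 1 ⊎ d ≡ q) → Irreducible q
trial-division s {q} q<s² small {d} d∣q@(divides k q≡k*d) with d <? s | k <? s
... | yes d<s | _ = small d<s d∣q
... | no d≮s | no k≮s = contradiction
      (subst (s * s ≤_) (sym q≡k*d) (*-mono-≤ (≮⇒≥ k≮s) (≮⇒≥ d≮s))) (<⇒≱ q<s²)
... | no _ | yes k<s with small k<s (divides d (trans q≡k*d (*-comm k d)))
...   | inj₁ refl = inj₂ (sym (trans q≡k*d (*-identityˡ d)))
...   | inj₂ refl = inj₁ (*-cancelˡ-≡ d 1 q (trans (sym q≡k*d) (sym (*-identityʳ q))))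

-- Each induction step on `i` removes one factor `u ^ t`, which is 1 modulo `m`.
∣-power-period : ∀ {m} u .{{_ : NonZero u}} t x c → m ∣ u ^ t ∸ 1 → ∀ i e →
                 m ∣ x * u ^ (i * t + e) + c → m ∣ x * u ^ e + c
∣-power-period u t x c m∣uᵗ-1 zero e m∣ = m∣
∣-power-period {m} u t x c m∣uᵗ-1 (suc i) e m∣ =
  ∣-power-period u t x c m∣uᵗ-1 i e
    (∣m+n∣m⇒∣n (subst (m ∣_) expand m∣) (∣m⇒∣m*n (x * y) m∣uᵗ-1))
  where
  open ≡-Reasoning
  w = u ^ t ∸ 1
  y = u ^ (i * t + e)
  regroup : ∀ x w y c → x * ((1 + w) * y) + c ≡ w * (x * y) + (x * y + c)
  regroup = solve-∀
  expand : x * u ^ (suc i * t + e) + c ≡ w * (x * y) + (x * y + c)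
  expand = begin
    x * u ^ (suc i * t + e) + c        ≡⟨ cong (λ k → x * u ^ k + c) (+-assoc t (i * t) e) ⟩
    x * u ^ (t + (i * t + e)) + c      ≡⟨ cong (λ z → x * z + c) (^-distribˡ-+-* u t (i * t + e)) ⟩
    x * (u ^ t * y) + c                ≡⟨ cong (λ z → x * (z * y) + c) (m+[n∸m]≡n (m^n>0 u t)) ⟨
    x * ((1 + w) * y) + c                  ≡⟨ regroup x w y c ⟩
    w * (x * y) + (x * y + c)              ∎

∣-sum-of-squares-mod : ∀ {r} .{{_ : NonZero r}} a b c →
                       r ∣ a + b * b + c → r ∣ a + b % r * (b % r) + c
∣-sum-of-squares-mod {r} a b c r∣ = ∣m+n∣m⇒∣n
  (subst (r ∣_) expand r∣) (divides ((b / r) * (2 * (b % r) + (b / r) * r)) refl)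
  where
  regroup : ∀ a c h k r → a + (h + k * r) * (h + k * r) + c ≡
                          k * (2 * h + k * r) * r + (a + h * h + c)
  regroup = solve-∀
  expand : a + b * b + c ≡
           (b / r) * (2 * (b % r) + (b / r) * r) * r + (a + b % r * (b % r) + c)
  expand = trans
    (cong (λ z → a + z * z + c) (m≡m%n+[m/n]*n b r))
    (regroup a c (b % r) (b / r) r)

-- Covering primes and quadratic obstructions.

≡3mod4-prime : ℕ → Set
≡3mod4-prime q = NonZero q × 4 ∣ suc q × Irreducible q

-- `e` stands for 2ⁿ - α. The covering prime `q` forces p = `q`, and `r` is a modulus for which -(q²
-- + e) is not a square.
Obstructed : List ℕ → ℕ → Set
Obstructed qs e = Any (λ q → q ∣ e ×
  Any (λ r → ∀ {b} → b < r → r ∤ q * q + b * b + e) qs) qs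

obstructed? : ∀ qs e → Dec (Obstructed qs e)
obstructed? qs e = any? (λ q → q ∣? e ×-dec
  any? (λ r → allUpTo? (λ b → ¬? (r ∣? q * q + b * b + e)) r) qs) qs

-- The covering prime divides both `e` and the whole sum, hence `p * p + b * b`, so it equals `p`;
-- then `r` excludes every residue of `b`.
obstructed⇒∤ : ∀ {qs e} → All ≡3mod4-prime qs → Obstructed qs e →
               ∀ {p} → Prime p → ∀ b → product qs ∤ p * p + b * b + e
obstructed⇒∤ {qs} {e} qs-prime obstructed {p} p-prime b ∏qs∣
  with q , q∈qs , q∣e , any-r ← find obstructed
  with r , r∈qs , r∤ ← find any-r
  = r∤ (m%n<n b r) (∣-sum-of-squares-mod (q * q) b e
      (subst (λ z → r ∣ z * z + b * b + e) p≡q (∣-trans (∈⇒∣product r∈qs) ∏qs∣)))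
  where
  instance
    _ = proj₁ (lookup qs-prime r∈qs)

  q∣p²+b² : q ∣ p * p + b * b
  q∣p²+b² = ∣m+n∣m⇒∣n
    (subst (q ∣_) (+-comm (p * p + b * b) e) (∣-trans (∈⇒∣product q∈qs) ∏qs∣)) q∣e

  p≡q : p ≡ q
  p≡q with _ , 4∣1+q , q-irr ← lookup qs-prime q∈qs
    = ∣p²+b²⇒p≡q p-prime q-irr 4∣1+q b q∣p²+b²

-- The order of 2 modulo each of these primes divides 9450 = 90 · 105.
moduli : List ℕ
moduli =
  3 ∷ 7 ∷ 11 ∷ 19 ∷ 31 ∷ 43 ∷ 71 ∷ 127 ∷ 151 ∷ 211 ∷ 251 ∷ 271 ∷ 331 ∷ 379 ∷
  631 ∷ 811 ∷ 1051 ∷ 4051 ∷ 5419 ∷ 23311 ∷ 29191 ∷ 39551 ∷ 86171 ∷ 87211 ∷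
  110251 ∷ 119827 ∷ 348031 ∷ 870031 ∷ 983431 ∷ 1560007 ∷ 1765891 ∷ []

M : ℕ
M = product moduli

-- β = −α.  Modulo 3, α ≡ 1 takes care of all even n; the remaining residues
-- α ≡ 2^a (mod q) come from a greedy computer search.
β : ℕ
β =
  178201365781822634642966081507979442336178014926517448803180460134820242037816184293704212377280581764142

-- Verification by computation.

-- 1330² = 1768900 exceeds the largest modulus, 1765891, so one trial bound serves all of them.
PassesTest : ℕ → Set
PassesTest q = 0 < q × q < 1330 * 1330 × 4 ∣ suc q ×
  (∀ {d} → d < 1330 → d ∣ q → d ≡ 1 ⊎ d ≡ q)

passesTest? : ∀ q → Dec (PassesTest q)
passesTest? q = 0 <? q ×-dec q <? 1330 * 1330 ×-dec 4 ∣? suc q ×-dec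
  allUpTo? (λ d → d ∣? q →-dec (d ≟ 1 ⊎-dec d ≟ q)) 1330

passesTest⇒≡3mod4-prime : ∀ {q} → PassesTest q → ≡3mod4-prime q
passesTest⇒≡3mod4-prime (0<q , q<1330² , 4∣1+q , small) =
  >-nonZero 0<q , 4∣1+q , trial-division 1330 {{>-nonZero 0<q}} q<1330² small

moduli-≡3mod4-prime : All ≡3mod4-prime moduli
moduli-≡3mod4-prime = All.map passesTest⇒≡3mod4-prime
  (toWitness {a? = all? passesTest? moduli} _)

M∣2^9450-1 : M ∣ (2 ^ 90) ^ 105 ∸ 1
M∣2^9450-1 = toWitness {a? = M ∣? (2 ^ 90) ^ 105 ∸ 1} _

-- Writing n = i + 90 j avoids recomputing 2ⁿ by n doublings for each n < 9450.
all-obstructed : ∀ {i} → i < 90 → ∀ {j} → j < 105 → Obstructed moduli (2 ^ i * (2 ^ 90) ^ j + β)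
all-obstructed = toWitness
  {a? = allUpTo? (λ i → allUpTo? (λ j → obstructed? moduli (2 ^ i * (2 ^ 90) ^ j + β)) 105) 90} _

m-[-n]≡m+n : ∀ m n → pos m ℤ.- (ℤ.- pos n) ≡ pos (m + n)
m-[-n]≡m+n m n = cong (λ i → pos m ℤ.+ i) (ℤ.neg-involutive (pos n))

-- With n = n % 90 + 90 (n / 90), the exponent of 2⁹⁰ is reduced modulo 105, which lands in the
-- range of `all-obstructed`.
M∤p²+b²+2ⁿ+β : ∀ {p} → Prime p → ∀ b n → M ∤ (p ^ 2 + b ^ 2 + 2 ^ n) + β
M∤p²+b²+2ⁿ+β {p} p-prime b n M∣ =
  obstructed⇒∤ moduli-≡3mod4-prime
    (all-obstructed (m%n<n n 90) (m%n<n (n / 90) 105)) p-prime b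
    (subst (M ∣_) (reorder x (2⁹⁰ ^ (n / 90 % 105)) p b β)
      (∣-power-period 2⁹⁰ 105 x (p * p + b * b + β) M∣2^9450-1
        (n / 90 / 105) (n / 90 % 105) (subst (M ∣_) expand M∣)))
  where
  open ≡-Reasoning
  2⁹⁰ = 2 ^ 90
  x = 2 ^ (n % 90)
  j≡ : n / 90 ≡ n / 90 / 105 * 105 + n / 90 % 105
  j≡ = trans (m≡m%n+[m/n]*n (n / 90) 105) (+-comm (n / 90 % 105) _)
  2ⁿ≡ : 2 ^ n ≡ x * 2⁹⁰ ^ (n / 90 / 105 * 105 + n / 90 % 105)
  2ⁿ≡ = begin
    2 ^ n                            ≡⟨ cong (2 ^_) (m≡m%n+[m/n]*n n 90) ⟩
    2 ^ (n % 90 + n / 90 * 90)       ≡⟨ ^-distribˡ-+-* 2 (n % 90) _ ⟩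
    x * 2 ^ (n / 90 * 90)            ≡⟨ cong (λ k → x * 2 ^ k) (*-comm (n / 90) 90) ⟩
    x * 2 ^ (90 * (n / 90))          ≡⟨ cong (x *_) (^-*-assoc 2 90 (n / 90)) ⟨
    x * 2⁹⁰ ^ (n / 90)               ≡⟨ cong (λ j → x * 2⁹⁰ ^ j) j≡ ⟩
    x * 2⁹⁰ ^ (n / 90 / 105 * 105 + n / 90 % 105) ∎
  regroup : ∀ p b y c → p * (p * 1) + b * (b * 1) + y + c ≡ y + (p * p + b * b + c)
  regroup = solve-∀
  reorder : ∀ x y p b c → x * y + (p * p + b * b + c) ≡ p * p + b * b + (x * y + c)
  reorder = solve-∀
  expand : p ^ 2 + b ^ 2 + 2 ^ n + β ≡
           x * 2⁹⁰ ^ (n / 90 / 105 * 105 + n / 90 % 105) + (p * p + b * b + β)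
  expand = trans (regroup p b (2 ^ n) β) (cong (_+ (p * p + b * b + β)) 2ⁿ≡)

theorem2 : ∃[ M ] ∃[ α ] 0 < M × Odd M ×
    (∀ (x : ℤ) → x ≡ α [mod M ] → ¬ PrimeSquare+Square+PowerOf2 x)
theorem2 = M , ℤ.- pos β , toWitness {a? = 0 <? M} _ , toWitness {a? = ¬? (2 ∣? M)} _ ,
  -- As α = -`β`, the difference x - α is the natural number p² + b² + 2ⁿ + `β`.
  λ { _ M∣x-α (p , b , n , p-prime , refl) → M∤p²+b²+2ⁿ+β p-prime b n
        (subst (λ z → M ∣ ℤ.∣ z ∣) (m-[-n]≡m+n (p ^ 2 + b ^ 2 + 2 ^ n) β) (∣⇒∣ᵤ M∣x-α)) }
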